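{- Let $M\ge1$ be an integer. For every $m\ge0$, $$f_m^{[M]}(t)=t^{(M-1)m}f_m^{[M]}(t^{ -1}).$$ Thus $(-1)^mf_m^{[M]}(t)$ is a palindromic polynomial with darga $(M-1)m$.
   Context: Let $t$ be an indeterminate. The coefficients $f_m^{[M]}(t)$ are defined by $F_{t,t^M}(u)=\sum_{m\ge0}f_m^{[M]}(t)u^m$, where $$F_{t,s}(u)=\exp\Big(-2\sum_{n\ge1,\ n\text{ odd}}\frac{1-s^n}{1-t^n}\frac{u^n}{n}\Big)$$ as a formal power series in $u$. A polynomial $f(t)$ is called palindromic of darga $d$ if $f(t)=t^df(t^{ -1})$; this convention permits zero coefficients at both ends of the degree interval $[0,d]$. -}

module Defs where

open import Algebra.Bundles.Raw using (RawRing)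
import Algebra.Definitions.RawSemiring as RawSemiringDefinitions
open import Data.Fin.Base using (toℕ)
open import Data.Integer.Base as ℤ using (+_)
open import Data.List.Base using (List; []; _∷_; map)
open import Data.Nat.Base as ℕ using (ℕ; zero; suc; _∸_; _!; parity)
open import Data.Nat.Properties using (_!≢0)
open import Data.Parity.Base using (Parity; 0ℙ; 1ℙ)
open import Data.Product.Base using (Σ-syntax)
open import Data.Rational.Base as ℚ using (ℚ; 0ℚ; 1ℚ)
import Data.Rational.Properties as ℚ
open import Data.Sum.Base using (_⊎_; inj₁; inj₂; [_,_]′; map₁)
open import Function.Base using (_∘_)
open import Level using (0ℓ)
open import Relation.Binary.PropositionalEquality
open import Relation.Nullary using (¬_; Dec; yes; no; contradiction)

------------------------------------------------------------------------
-- ℚ[t]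

-- Coefficient lists, constant term first.  Trailing zeros are allowed, so
-- equality of polynomials is _≈ₚ_ and not _≡_.

Poly : Set
Poly = List ℚ

coeff : Poly → ℕ → ℚ
coeff []      _       = 0ℚ
coeff (a ∷ p) zero    = a
coeff (a ∷ p) (suc i) = coeff p i

infix 4 _≈ₚ_

record _≈ₚ_ (p q : Poly) : Set where
  constructor coeffwise
  field coeff-≡ : ∀ i → coeff p i ≡ coeff q i

open _≈ₚ_ public

infixl 6 _+ₚ_
infixl 7 _*ₚ_

_+ₚ_ : Poly → Poly → Poly
[]      +ₚ q       = q
p       +ₚ []      = p
(a ∷ p) +ₚ (b ∷ q) = (a ℚ.+ b) ∷ (p +ₚ q)

-ₚ_ : Poly → Poly
-ₚ p = map ℚ.-_ p

_*ₚ_ : Poly → Poly → Poly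
[]      *ₚ q = []
(a ∷ p) *ₚ q = map (a ℚ.*_) q +ₚ (0ℚ ∷ p *ₚ q)

NonZeroₚ : Poly → Set
NonZeroₚ p = ¬ (p ≈ₚ [])

private
  ∷-zero : ∀ {a p} → a ≡ 0ℚ → p ≈ₚ [] → (a ∷ p) ≈ₚ []
  ∷-zero a≡0 p≈0 = coeffwise λ { zero → a≡0 ; (suc i) → coeff-≡ p≈0 i }

  tail-zero : ∀ {a p} → (a ∷ p) ≈ₚ [] → p ≈ₚ []
  tail-zero ap≈0 = coeffwise (coeff-≡ ap≈0 ∘ suc)

zero? : (p : Poly) → Dec (p ≈ₚ [])
zero? []      = yes (coeffwise λ _ → refl)
zero? (a ∷ p) with a ℚ.≟ 0ℚ | zero? p
... | yes a≡0 | yes p≈0 = yes (∷-zero a≡0 p≈0)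
... | no  a≢0 | _       = no λ ap≈0 → a≢0 (coeff-≡ ap≈0 0)
... | yes _   | no p≉0  = no (p≉0 ∘ tail-zero)

private
  coeff-+ : ∀ p q i → coeff (p +ₚ q) i ≡ coeff p i ℚ.+ coeff q i
  coeff-+ []      q       i       = sym (ℚ.+-identityˡ _)
  coeff-+ (a ∷ p) []      i       = sym (ℚ.+-identityʳ _)
  coeff-+ (a ∷ p) (b ∷ q) zero    = refl
  coeff-+ (a ∷ p) (b ∷ q) (suc i) = coeff-+ p q i

  coeff-scale : ∀ a q i → coeff (map (a ℚ.*_) q) i ≡ a ℚ.* coeff q i
  coeff-scale a []      i       = sym (ℚ.*-zeroʳ a)
  coeff-scale a (b ∷ q) zero    = refl
  coeff-scale a (b ∷ q) (suc i) = coeff-scale a q i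

  coeff-∷* : ∀ a p q i →
             coeff ((a ∷ p) *ₚ q) i ≡ a ℚ.* coeff q i ℚ.+ coeff (0ℚ ∷ p *ₚ q) i
  coeff-∷* a p q i =
    trans (coeff-+ (map (a ℚ.*_) q) (0ℚ ∷ p *ₚ q) i)
          (cong (ℚ._+ coeff (0ℚ ∷ p *ₚ q) i) (coeff-scale a q i))

  integralℚ : ∀ {a b} → a ≢ 0ℚ → a ℚ.* b ≡ 0ℚ → b ≡ 0ℚ
  integralℚ {a} {b} a≢0 ab≡0 = begin
    b                     ≡⟨ ℚ.*-identityˡ b ⟨
    1ℚ ℚ.* b              ≡⟨ cong (ℚ._* b) (ℚ.*-inverseˡ a) ⟨
    ℚ.1/ a ℚ.* a ℚ.* b    ≡⟨ ℚ.*-assoc (ℚ.1/ a) a b ⟩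
    ℚ.1/ a ℚ.* (a ℚ.* b)  ≡⟨ cong (ℚ.1/ a ℚ.*_) ab≡0 ⟩
    ℚ.1/ a ℚ.* 0ℚ         ≡⟨ ℚ.*-zeroʳ (ℚ.1/ a) ⟩
    0ℚ                    ∎
    where
    open ≡-Reasoning
    instance _ = ℚ.≢-nonZero a≢0

  cancel-zeroˡ : ∀ {x y} → x ≡ 0ℚ → x ℚ.+ y ≡ 0ℚ → y ≡ 0ℚ
  cancel-zeroˡ {y = y} refl x+y≡0 = trans (sym (ℚ.+-identityˡ y)) x+y≡0

  cancel-zeroʳ : ∀ {x y} → y ≡ 0ℚ → x ℚ.+ y ≡ 0ℚ → x ≡ 0ℚ
  cancel-zeroʳ {x} refl x+y≡0 = trans (sym (ℚ.+-identityʳ x)) x+y≡0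

  zeroCoeff* : ∀ {a} x → a ≡ 0ℚ → a ℚ.* x ≡ 0ℚ
  zeroCoeff* x refl = ℚ.*-zeroˡ x

  coeff-*0∷ : ∀ p {b} q → b ≡ 0ℚ → ∀ i →
              coeff (p *ₚ (b ∷ q)) i ≡ coeff (0ℚ ∷ p *ₚ q) i
  coeff-*0∷ []      q b≡0 zero    = refl
  coeff-*0∷ []      q b≡0 (suc i) = refl
  coeff-*0∷ (a ∷ p) {b} q b≡0 zero =
    trans (coeff-∷* a p (b ∷ q) 0)
          (trans (ℚ.+-identityʳ _) (trans (cong (a ℚ.*_) b≡0) (ℚ.*-zeroʳ a)))
  coeff-*0∷ (a ∷ p) {b} q b≡0 (suc i) =
    trans (coeff-∷* a p (b ∷ q) (suc i))
          (trans (cong (a ℚ.* coeff q i ℚ.+_) (coeff-*0∷ p q b≡0 i))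
                 (sym (coeff-∷* a p q i)))

  integral-∷ : ∀ {a} p q → a ≢ 0ℚ → (a ∷ p) *ₚ q ≈ₚ [] → q ≈ₚ []
  integral-∷ p []      a≢0 _    = coeffwise λ _ → refl
  integral-∷ {a} p (b ∷ q) a≢0 pq≈0 = ∷-zero b≡0 (integral-∷ p q a≢0
    (coeffwise λ i → trans (sym (coeff-*0∷ (a ∷ p) q b≡0 (suc i)))
                           (coeff-≡ pq≈0 (suc i))))
    where
    b≡0 : b ≡ 0ℚ
    b≡0 = integralℚ a≢0
      (cancel-zeroʳ refl (trans (sym (coeff-∷* a p (b ∷ q) 0)) (coeff-≡ pq≈0 0)))

integralₚ : ∀ p q → p *ₚ q ≈ₚ [] → p ≈ₚ [] ⊎ q ≈ₚ []
integralₚ []      q _    = inj₁ (coeffwise λ _ → refl)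
integralₚ (a ∷ p) q pq≈0 with a ℚ.≟ 0ℚ
... | no  a≢0 = inj₂ (integral-∷ p q a≢0 pq≈0)
... | yes a≡0 = map₁ (∷-zero a≡0) (integralₚ p q (coeffwise λ i →
        cancel-zeroˡ (zeroCoeff* (coeff q (suc i)) a≡0)
          (trans (sym (coeff-∷* a p q (suc i))) (coeff-≡ pq≈0 (suc i)))))

*ₚ-nonZero : ∀ {p q} → NonZeroₚ p → NonZeroₚ q → NonZeroₚ (p *ₚ q)
*ₚ-nonZero {p} {q} p≉0 q≉0 = [ p≉0 , q≉0 ]′ ∘ integralₚ p q

1ₚ-nonZero : NonZeroₚ (1ℚ ∷ [])
1ₚ-nonZero 1≈0 = contradiction (coeff-≡ 1≈0 0) λ ()

------------------------------------------------------------------------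
-- ℚ(t), the field of fractions of ℚ[t]

record RatFun : Set where
  constructor _/_[_]
  field
    num         : Poly
    den         : Poly
    den-nonZero : NonZeroₚ den

open RatFun public

infix 4 _≃_

data _≃_ (x y : RatFun) : Set where
  cross : num x *ₚ den y ≈ₚ num y *ₚ den x → x ≃ y

polynomial : Poly → RatFun
polynomial p = p / 1ℚ ∷ [] [ 1ₚ-nonZero ]

const : ℚ → RatFun
const a = polynomial (a ∷ [])

0# 1# t : RatFun
0# = polynomial []
1# = const 1ℚ
t  = polynomial (0ℚ ∷ 1ℚ ∷ [])

infixl 6 _+_ _-_
infixl 7 _*_ _÷_
infix  8 -_
infix  9 _⁻¹

_+_ : RatFun → RatFun → RatFun
x + y = (num x *ₚ den y +ₚ num y *ₚ den x) / den x *ₚ den y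
          [ *ₚ-nonZero {den x} {den y} (den-nonZero x) (den-nonZero y) ]

_*_ : RatFun → RatFun → RatFun
x * y = (num x *ₚ num y) / den x *ₚ den y
          [ *ₚ-nonZero {den x} {den y} (den-nonZero x) (den-nonZero y) ]

-_ : RatFun → RatFun
- x = (-ₚ num x) / den x [ den-nonZero x ]

_-_ : RatFun → RatFun → RatFun
x - y = x + (- y)

-- Total, with 0 ⁻¹ = 0; the theorem only inverts nonzero elements
-- (t, 1 - tⁿ with n ≥ 1, and q(t⁻¹) with q a nonzero polynomial).

_⁻¹ : RatFun → RatFun
x ⁻¹ with zero? (num x)
... | yes _  = 0#
... | no x≉0 = den x / num x [ x≉0 ]

_÷_ : RatFun → RatFun → RatFun
x ÷ y = x * y ⁻¹

ratFunRawRing : RawRing 0ℓ 0ℓ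
ratFunRawRing = record
  { Carrier = RatFun ; _≈_ = _≃_
  ; _+_ = _+_ ; _*_ = _*_ ; -_ = -_ ; 0# = 0# ; 1# = 1# }

open RawSemiringDefinitions (RawRing.rawSemiring ratFunRawRing) public
  using (_^_; sum)

evalₚ : Poly → RatFun → RatFun
evalₚ []      x = 0#
evalₚ (a ∷ p) x = const a + x * evalₚ p x

-- The substitution f(t) ↦ f(x).  It is meaningful only when the denominator
-- of f does not vanish at x, which is automatic for x = t⁻¹.

_⟨_⟩ : RatFun → RatFun → RatFun
f ⟨ x ⟩ = evalₚ (num f) x ÷ evalₚ (den f) x

PalindromicOfDarga : ℕ → RatFun → Set
PalindromicOfDarga d f = f ≃ t ^ d * f ⟨ t ⁻¹ ⟩

IsPolynomial : RatFun → Set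
IsPolynomial f = Σ[ p ∈ Poly ] f ≃ polynomial p

------------------------------------------------------------------------
-- ℚ(t)[[u]]

Series : Set
Series = ℕ → RatFun

infixl 7 _*ₛ_ _·ₛ_
infixr 8 _^ₛ_

1ₛ : Series
1ₛ zero    = 1#
1ₛ (suc _) = 0#

_·ₛ_ : RatFun → Series → Series
(c ·ₛ G) n = c * G n

_*ₛ_ : Series → Series → Series
(G *ₛ H) n = sum {suc n} λ i → G (toℕ i) * H (n ∸ toℕ i)

_^ₛ_ : Series → ℕ → Series
G ^ₛ zero  = 1ₛ
G ^ₛ suc k = G *ₛ G ^ₛ k

-- exp G = Σₖ Gᵏ/k!, for G with zero constant term.  Then Gᵏ contributes
-- nothing to the coefficient of uᵐ when k > m, so the sum stops at k = m.

1/_! : ℕ → ℚ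
1/ k ! = (+ 1 ℚ./ (k !)) {{k !≢0}}

exp : Series → Series
exp G m = sum {suc m} λ k → const (1/ toℕ k !) * (G ^ₛ toℕ k) m

whenOdd : Parity → RatFun → RatFun
whenOdd 0ℙ _ = 0#
whenOdd 1ℙ x = x

-- Σ_{n ≥ 1, n odd} (1 - sⁿ)/(1 - qⁿ) uⁿ/n

oddSeries : RatFun → RatFun → Series
oddSeries q s zero      = 0#
oddSeries q s n@(suc _) =
  whenOdd (parity n) ((1# - s ^ n) ÷ (1# - q ^ n) * const (+ 1 ℚ./ n))

F : RatFun → RatFun → Series
F q s = exp (- const (+ 2 ℚ./ 1) ·ₛ oddSeries q s)

f[_] : ℕ → ℕ → RatFun
f[ M ] m = F t (t ^ M) m

{-# OPTIONS --safe #-}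
module Submission where

-- Write M = k + 1.  Call x in ℚ(t) homogeneous of weight n if x is a
-- polynomial and x = t^(kn) σ(x), where σ is the substitution t ↦ t⁻¹.  The
-- theorem says that the coefficient of u^m in F is homogeneous of weight m
-- (the sign (-1)^m has weight 0).
--
-- Since σ is a ring endomorphism of ℚ(t) fixing ℚ, homogeneous elements of
-- a given weight are closed under addition and rational scaling, and weights
-- add under multiplication.  Hence if the coefficient of u^n in a series G is
-- homogeneous of weight n for every n, the same holds for products and
-- powers of G, and for exp G (homogeneous-exp).  It remains to see that
-- (1 - t^(Mn))/(1 - t^n) is homogeneous of weight n for n ≥ 1: it is a
-- geometric sum, hence a polynomial (geometric-isPolynomial), and applying σ
-- to numerator and denominator multiplies them by -t^(-Mn) and -t^(-n), so
-- that t^(Mn - n) σ of the quotient is the quotient again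
-- (quotient-palindromic).
--
-- All of this takes place in ℚ(t), so ℚ[t] and ℚ(t) are first shown to be
-- commutative rings.  That σ respects equality of fractions amounts to
-- q(t⁻¹) ≠ 0 for every nonzero polynomial q (eval-nonZero): up to a power
-- of t, q(t⁻¹) is the polynomial with the coefficients of q reversed.

open import Defs
open import Algebra.Bundles using (CommutativeRing)
import Algebra.Properties.Group as GroupProperties
import Algebra.Properties.Ring as RingProperties
import Algebra.Properties.Semiring.Exp as Exp
open import Data.Fin.Base using (Fin; zero; suc; toℕ)
open import Data.Fin.Properties using (toℕ≤pred[n])
open import Data.Integer.Base using (+_)
open import Data.List.Base using ([]; _∷_; map; length; _ʳ++_)
open import Data.Nat.Base as ℕ using (ℕ; zero; suc; _≤_; _∸_; parity)
import Data.Nat.Properties as ℕ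
open import Data.Parity.Base using (0ℙ; 1ℙ)
open import Data.Rational.Base as ℚ using (ℚ; 0ℚ; 1ℚ)
import Data.Rational.Properties as ℚ
open import Data.Maybe.Base using (nothing)
open import Data.Product.Base using (_×_; _,_; proj₁)
open import Data.Sum.Base using ([_,_]′)
open import Level using (0ℓ)
open import Relation.Binary.Bundles using (Setoid)
open import Relation.Binary.PropositionalEquality as ≡ using (_≡_)
import Relation.Binary.Reasoning.Setoid as SetoidReasoning
open import Relation.Nullary using (¬_; yes; no; contradiction)
open import Tactic.RingSolver using (solve-∀)
open import Tactic.RingSolver.Core.AlmostCommutativeRing
  using (AlmostCommutativeRing; fromCommutativeRing)

-- The ring ℚ[t]

polySetoid : Setoid 0ℓ 0ℓ
polySetoid = record
  { Carrier = Poly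
  ; _≈_ = _≈ₚ_
  ; isEquivalence = record
    { refl  = coeffwise λ _ → ≡.refl
    ; sym   = λ e → coeffwise λ i → ≡.sym (coeff-≡ e i)
    ; trans = λ e f → coeffwise λ i → ≡.trans (coeff-≡ e i) (coeff-≡ f i)
    }
  }

module ≈ₚ = Setoid polySetoid

∷-congₚ : ∀ {a b p q} → a ≡ b → p ≈ₚ q → a ∷ p ≈ₚ b ∷ q
∷-congₚ e f = coeffwise λ { zero → e ; (suc i) → coeff-≡ f i }

coeff-+ₚ : ∀ p q i → coeff (p +ₚ q) i ≡ coeff p i ℚ.+ coeff q i
coeff-+ₚ []      q       i       = ≡.sym (ℚ.+-identityˡ _)
coeff-+ₚ (a ∷ p) []      i       = ≡.sym (ℚ.+-identityʳ _)
coeff-+ₚ (a ∷ p) (b ∷ q) zero    = ≡.refl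
coeff-+ₚ (a ∷ p) (b ∷ q) (suc i) = coeff-+ₚ p q i

infixr 7 _·ₚ_

-- Multiplication of a polynomial by a scalar, spelled as in the definition
-- of _*ₚ_.

_·ₚ_ : ℚ → Poly → Poly
a ·ₚ p = map (a ℚ.*_) p

coeff-·ₚ : ∀ a q i → coeff (a ·ₚ q) i ≡ a ℚ.* coeff q i
coeff-·ₚ a []      i       = ≡.sym (ℚ.*-zeroʳ a)
coeff-·ₚ a (b ∷ q) zero    = ≡.refl
coeff-·ₚ a (b ∷ q) (suc i) = coeff-·ₚ a q i

coeff--ₚ : ∀ p i → coeff (-ₚ p) i ≡ ℚ.- coeff p i
coeff--ₚ []      i       = ≡.refl
coeff--ₚ (a ∷ p) zero    = ≡.refl
coeff--ₚ (a ∷ p) (suc i) = coeff--ₚ p i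

+ₚ-cong : ∀ {p p′ q q′} → p ≈ₚ p′ → q ≈ₚ q′ → p +ₚ q ≈ₚ p′ +ₚ q′
+ₚ-cong {p} {p′} {q} {q′} e f = coeffwise λ i → begin
  coeff (p +ₚ q) i           ≡⟨ coeff-+ₚ p q i ⟩
  coeff p i ℚ.+ coeff q i    ≡⟨ ≡.cong₂ ℚ._+_ (coeff-≡ e i) (coeff-≡ f i) ⟩
  coeff p′ i ℚ.+ coeff q′ i  ≡⟨ coeff-+ₚ p′ q′ i ⟨
  coeff (p′ +ₚ q′) i         ∎
  where open ≡.≡-Reasoning

+ₚ-assoc : ∀ p q r → (p +ₚ q) +ₚ r ≈ₚ p +ₚ (q +ₚ r)
+ₚ-assoc p q r = coeffwise λ i → begin
  coeff (p +ₚ q +ₚ r) i                      ≡⟨ coeff-+ₚ (p +ₚ q) r i ⟩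
  coeff (p +ₚ q) i ℚ.+ coeff r i             ≡⟨ ≡.cong (ℚ._+ coeff r i) (coeff-+ₚ p q i) ⟩
  coeff p i ℚ.+ coeff q i ℚ.+ coeff r i      ≡⟨ ℚ.+-assoc (coeff p i) (coeff q i) (coeff r i) ⟩
  coeff p i ℚ.+ (coeff q i ℚ.+ coeff r i)    ≡⟨ ≡.cong (coeff p i ℚ.+_) (coeff-+ₚ q r i) ⟨
  coeff p i ℚ.+ coeff (q +ₚ r) i             ≡⟨ coeff-+ₚ p (q +ₚ r) i ⟨
  coeff (p +ₚ (q +ₚ r)) i                    ∎
  where open ≡.≡-Reasoning

+ₚ-comm : ∀ p q → p +ₚ q ≈ₚ q +ₚ p
+ₚ-comm p q = coeffwise λ i → begin
  coeff (p +ₚ q) i         ≡⟨ coeff-+ₚ p q i ⟩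
  coeff p i ℚ.+ coeff q i  ≡⟨ ℚ.+-comm (coeff p i) (coeff q i) ⟩
  coeff q i ℚ.+ coeff p i  ≡⟨ coeff-+ₚ q p i ⟨
  coeff (q +ₚ p) i         ∎
  where open ≡.≡-Reasoning

+ₚ-identityʳ : ∀ p → p +ₚ [] ≈ₚ p
+ₚ-identityʳ []      = ≈ₚ.refl
+ₚ-identityʳ (a ∷ p) = ≈ₚ.refl

-ₚ-cong : ∀ {p q} → p ≈ₚ q → -ₚ p ≈ₚ -ₚ q
-ₚ-cong {p} {q} e = coeffwise λ i →
  ≡.trans (coeff--ₚ p i) (≡.trans (≡.cong ℚ.-_ (coeff-≡ e i)) (≡.sym (coeff--ₚ q i)))

-ₚ-inverseʳ : ∀ p → p +ₚ (-ₚ p) ≈ₚ []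
-ₚ-inverseʳ []      = ≈ₚ.refl
-ₚ-inverseʳ (a ∷ p) = coeffwise λ where
  zero    → ℚ.+-inverseʳ a
  (suc i) → coeff-≡ (-ₚ-inverseʳ p) i

·ₚ-cong : ∀ {a b p q} → a ≡ b → p ≈ₚ q → a ·ₚ p ≈ₚ b ·ₚ q
·ₚ-cong {a} {p = p} {q} ≡.refl e = coeffwise λ i →
  ≡.trans (coeff-·ₚ a p i)
    (≡.trans (≡.cong (a ℚ.*_) (coeff-≡ e i)) (≡.sym (coeff-·ₚ a q i)))

·ₚ-distribˡ : ∀ a p q → a ·ₚ (p +ₚ q) ≈ₚ a ·ₚ p +ₚ a ·ₚ q
·ₚ-distribˡ a []      q       = ≈ₚ.refl
·ₚ-distribˡ a (b ∷ p) []      = ≈ₚ.refl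
·ₚ-distribˡ a (b ∷ p) (c ∷ q) = ∷-congₚ (ℚ.*-distribˡ-+ a b c) (·ₚ-distribˡ a p q)

·ₚ-distribʳ : ∀ a b p → (a ℚ.+ b) ·ₚ p ≈ₚ a ·ₚ p +ₚ b ·ₚ p
·ₚ-distribʳ a b []      = ≈ₚ.refl
·ₚ-distribʳ a b (c ∷ p) = ∷-congₚ (ℚ.*-distribʳ-+ c a b) (·ₚ-distribʳ a b p)

·ₚ-assoc : ∀ a b p → (a ℚ.* b) ·ₚ p ≈ₚ a ·ₚ b ·ₚ p
·ₚ-assoc a b []      = ≈ₚ.refl
·ₚ-assoc a b (c ∷ p) = ∷-congₚ (ℚ.*-assoc a b c) (·ₚ-assoc a b p)

·ₚ-zeroˡ : ∀ p → 0ℚ ·ₚ p ≈ₚ []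
·ₚ-zeroˡ []      = ≈ₚ.refl
·ₚ-zeroˡ (a ∷ p) = coeffwise λ where
  zero    → ℚ.*-zeroˡ a
  (suc i) → coeff-≡ (·ₚ-zeroˡ p) i

·ₚ-identityˡ : ∀ p → 1ℚ ·ₚ p ≈ₚ p
·ₚ-identityˡ []      = ≈ₚ.refl
·ₚ-identityˡ (a ∷ p) = ∷-congₚ (ℚ.*-identityˡ a) (·ₚ-identityˡ p)

0∷[] : 0ℚ ∷ [] ≈ₚ []
0∷[] = coeffwise λ { zero → ≡.refl ; (suc i) → ≡.refl }

+ₚ-interchange : ∀ p q r s → (p +ₚ q) +ₚ (r +ₚ s) ≈ₚ (p +ₚ r) +ₚ (q +ₚ s)
+ₚ-interchange p q r s = begin
  (p +ₚ q) +ₚ (r +ₚ s)  ≈⟨ +ₚ-assoc p q (r +ₚ s) ⟩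
  p +ₚ (q +ₚ (r +ₚ s))  ≈⟨ +ₚ-cong {p} ≈ₚ.refl (+ₚ-assoc q r s) ⟨
  p +ₚ ((q +ₚ r) +ₚ s)  ≈⟨ +ₚ-cong {p} ≈ₚ.refl (+ₚ-cong (+ₚ-comm q r) (≈ₚ.refl {s})) ⟩
  p +ₚ ((r +ₚ q) +ₚ s)  ≈⟨ +ₚ-cong {p} ≈ₚ.refl (+ₚ-assoc r q s) ⟩
  p +ₚ (r +ₚ (q +ₚ s))  ≈⟨ +ₚ-assoc p r (q +ₚ s) ⟨
  (p +ₚ r) +ₚ (q +ₚ s)  ∎
  where open SetoidReasoning polySetoid

*ₚ-zeroʳ : ∀ p → p *ₚ [] ≈ₚ []
*ₚ-zeroʳ []      = ≈ₚ.refl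
*ₚ-zeroʳ (a ∷ p) = ≈ₚ.trans (∷-congₚ ≡.refl (*ₚ-zeroʳ p)) 0∷[]

-- The recursion for _*ₚ_ in its second argument, from which commutativity
-- follows by induction.

*ₚ-∷ : ∀ p b q → p *ₚ (b ∷ q) ≈ₚ b ·ₚ p +ₚ (0ℚ ∷ p *ₚ q)
*ₚ-∷ []      b q = ≈ₚ.sym 0∷[]
*ₚ-∷ (a ∷ p) b q = ∷-congₚ (≡.cong (ℚ._+ 0ℚ) (ℚ.*-comm a b)) (begin
  a ·ₚ q +ₚ p *ₚ (b ∷ q)                ≈⟨ +ₚ-cong {a ·ₚ q} ≈ₚ.refl (*ₚ-∷ p b q) ⟩
  a ·ₚ q +ₚ (b ·ₚ p +ₚ (0ℚ ∷ p *ₚ q))   ≈⟨ +ₚ-assoc (a ·ₚ q) (b ·ₚ p) _ ⟨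
  (a ·ₚ q +ₚ b ·ₚ p) +ₚ (0ℚ ∷ p *ₚ q)   ≈⟨ +ₚ-cong (+ₚ-comm (a ·ₚ q) (b ·ₚ p)) ≈ₚ.refl ⟩
  (b ·ₚ p +ₚ a ·ₚ q) +ₚ (0ℚ ∷ p *ₚ q)   ≈⟨ +ₚ-assoc (b ·ₚ p) (a ·ₚ q) _ ⟩
  b ·ₚ p +ₚ (a ·ₚ q +ₚ (0ℚ ∷ p *ₚ q))   ∎)
  where open SetoidReasoning polySetoid

*ₚ-comm : ∀ p q → p *ₚ q ≈ₚ q *ₚ p
*ₚ-comm []      q = ≈ₚ.sym (*ₚ-zeroʳ q)
*ₚ-comm (a ∷ p) q = begin
  a ·ₚ q +ₚ (0ℚ ∷ p *ₚ q)  ≈⟨ +ₚ-cong {a ·ₚ q} ≈ₚ.refl (∷-congₚ ≡.refl (*ₚ-comm p q)) ⟩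
  a ·ₚ q +ₚ (0ℚ ∷ q *ₚ p)  ≈⟨ *ₚ-∷ q a p ⟨
  q *ₚ (a ∷ p)             ∎
  where open SetoidReasoning polySetoid

-- Congruence in the second argument is a plain induction on the first;
-- congruence in the first argument then follows by commutativity.

*ₚ-congˡ : ∀ p {q q′} → q ≈ₚ q′ → p *ₚ q ≈ₚ p *ₚ q′
*ₚ-congˡ []      e = ≈ₚ.refl
*ₚ-congˡ (a ∷ p) e = +ₚ-cong (·ₚ-cong {a} ≡.refl e) (∷-congₚ ≡.refl (*ₚ-congˡ p e))

*ₚ-cong : ∀ {p p′ q q′} → p ≈ₚ p′ → q ≈ₚ q′ → p *ₚ q ≈ₚ p′ *ₚ q′
*ₚ-cong {p} {p′} {q} {q′} e f = begin
  p *ₚ q    ≈⟨ *ₚ-congˡ p f ⟩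
  p *ₚ q′   ≈⟨ *ₚ-comm p q′ ⟩
  q′ *ₚ p   ≈⟨ *ₚ-congˡ q′ e ⟩
  q′ *ₚ p′  ≈⟨ *ₚ-comm q′ p′ ⟩
  p′ *ₚ q′  ∎
  where open SetoidReasoning polySetoid

*ₚ-distribʳ : ∀ r p q → (p +ₚ q) *ₚ r ≈ₚ p *ₚ r +ₚ q *ₚ r
*ₚ-distribʳ r []      q       = ≈ₚ.refl
*ₚ-distribʳ r (a ∷ p) []      = ≈ₚ.sym (+ₚ-identityʳ _)
*ₚ-distribʳ r (a ∷ p) (b ∷ q) = begin
  (a ℚ.+ b) ·ₚ r +ₚ (0ℚ ∷ (p +ₚ q) *ₚ r)
    ≈⟨ +ₚ-cong (·ₚ-distribʳ a b r) (∷-congₚ ≡.refl (*ₚ-distribʳ r p q)) ⟩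
  (a ·ₚ r +ₚ b ·ₚ r) +ₚ ((0ℚ ∷ p *ₚ r) +ₚ (0ℚ ∷ q *ₚ r))
    ≈⟨ +ₚ-interchange (a ·ₚ r) (b ·ₚ r) (0ℚ ∷ p *ₚ r) (0ℚ ∷ q *ₚ r) ⟩
  (a ·ₚ r +ₚ (0ℚ ∷ p *ₚ r)) +ₚ (b ·ₚ r +ₚ (0ℚ ∷ q *ₚ r))
    ∎
  where open SetoidReasoning polySetoid

·ₚ-*ₚ : ∀ a p q → (a ·ₚ p) *ₚ q ≈ₚ a ·ₚ (p *ₚ q)
·ₚ-*ₚ a []      q = ≈ₚ.refl
·ₚ-*ₚ a (b ∷ p) q = begin
  (a ℚ.* b) ·ₚ q +ₚ (0ℚ ∷ (a ·ₚ p) *ₚ q)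
    ≈⟨ +ₚ-cong (·ₚ-assoc a b q) (∷-congₚ (≡.sym (ℚ.*-zeroʳ a)) (·ₚ-*ₚ a p q)) ⟩
  a ·ₚ b ·ₚ q +ₚ a ·ₚ (0ℚ ∷ p *ₚ q)
    ≈⟨ ·ₚ-distribˡ a (b ·ₚ q) (0ℚ ∷ p *ₚ q) ⟨
  a ·ₚ (b ·ₚ q +ₚ (0ℚ ∷ p *ₚ q))
    ∎
  where open SetoidReasoning polySetoid

0∷-*ₚ : ∀ p q → (0ℚ ∷ p) *ₚ q ≈ₚ 0ℚ ∷ p *ₚ q
0∷-*ₚ p q = +ₚ-cong {q = 0ℚ ∷ p *ₚ q} (·ₚ-zeroˡ q) ≈ₚ.refl

*ₚ-assoc : ∀ p q r → (p *ₚ q) *ₚ r ≈ₚ p *ₚ (q *ₚ r)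
*ₚ-assoc []      q r = ≈ₚ.refl
*ₚ-assoc (a ∷ p) q r = begin
  (a ·ₚ q +ₚ (0ℚ ∷ p *ₚ q)) *ₚ r
    ≈⟨ *ₚ-distribʳ r (a ·ₚ q) (0ℚ ∷ p *ₚ q) ⟩
  (a ·ₚ q) *ₚ r +ₚ (0ℚ ∷ p *ₚ q) *ₚ r
    ≈⟨ +ₚ-cong (·ₚ-*ₚ a q r) (≈ₚ.trans (0∷-*ₚ (p *ₚ q) r) (∷-congₚ ≡.refl (*ₚ-assoc p q r))) ⟩
  a ·ₚ (q *ₚ r) +ₚ (0ℚ ∷ p *ₚ (q *ₚ r))
    ∎
  where open SetoidReasoning polySetoid

*ₚ-identityˡ : ∀ p → (1ℚ ∷ []) *ₚ p ≈ₚ p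
*ₚ-identityˡ p = begin
  1ℚ ·ₚ p +ₚ (0ℚ ∷ [])  ≈⟨ +ₚ-cong (·ₚ-identityˡ p) 0∷[] ⟩
  p +ₚ []               ≈⟨ +ₚ-identityʳ p ⟩
  p                     ∎
  where open SetoidReasoning polySetoid

polyRing : CommutativeRing 0ℓ 0ℓ
polyRing = record
  { Carrier = Poly
  ; _≈_ = _≈ₚ_
  ; _+_ = _+ₚ_
  ; _*_ = _*ₚ_
  ; -_  = -ₚ_
  ; 0#  = []
  ; 1#  = 1ℚ ∷ []
  ; isCommutativeRing = record
    { isRing = record
      { +-isAbelianGroup = record
        { isGroup = record
          { isMonoid = record
            { isSemigroup = record
              { isMagma = record
                { isEquivalence = Setoid.isEquivalence polySetoid
                ; ∙-cong = +ₚ-cong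
                }
              ; assoc = +ₚ-assoc
              }
            ; identity = (λ _ → ≈ₚ.refl) , +ₚ-identityʳ
            }
          ; inverse = (λ p → ≈ₚ.trans (+ₚ-comm (-ₚ p) p) (-ₚ-inverseʳ p)) , -ₚ-inverseʳ
          ; ⁻¹-cong = -ₚ-cong
          }
        ; comm = +ₚ-comm
        }
      ; *-cong = *ₚ-cong
      ; *-assoc = *ₚ-assoc
      ; *-identity = *ₚ-identityˡ , λ p → ≈ₚ.trans (*ₚ-comm p _) (*ₚ-identityˡ p)
      ; distrib = (λ p q r → ≈ₚ.trans (*ₚ-comm p (q +ₚ r))
                     (≈ₚ.trans (*ₚ-distribʳ p q r) (+ₚ-cong (*ₚ-comm q p) (*ₚ-comm r p))))
                , *ₚ-distribʳ
      }
    ; *-comm = *ₚ-comm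
    }
  }

-- ℚ[t] in the form used by the ring solver.  No coefficient is recognised as
-- zero, so the solver proves identities that need no cancellation.

polyACR : AlmostCommutativeRing 0ℓ 0ℓ
polyACR = fromCommutativeRing polyRing λ _ → nothing

*ₚ-identityʳ : ∀ p → p *ₚ (1ℚ ∷ []) ≈ₚ p
*ₚ-identityʳ = CommutativeRing.*-identityʳ polyRing

-- ℚ[t] is an integral domain; this is what makes _≃_ transitive.

*ₚ-cancelˡ : ∀ {p q r} → NonZeroₚ p → p *ₚ q ≈ₚ p *ₚ r → q ≈ₚ r
*ₚ-cancelˡ {p} {q} {r} p≉0 pq≈pr = x∙y⁻¹≈ε⇒x≈y q r
  ([ (λ p≈0 → contradiction p≈0 p≉0) , (λ e → e) ]′ (integralₚ p (q +ₚ -ₚ r) (begin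
    p *ₚ (q +ₚ -ₚ r)          ≈⟨ expand p q r ⟩
    p *ₚ q +ₚ -ₚ (p *ₚ r)     ≈⟨ +ₚ-cong pq≈pr ≈ₚ.refl ⟩
    p *ₚ r +ₚ -ₚ (p *ₚ r)     ≈⟨ -ₚ-inverseʳ (p *ₚ r) ⟩
    []                        ∎)))
  where
  open SetoidReasoning polySetoid
  open GroupProperties (CommutativeRing.+-group polyRing) using (x∙y⁻¹≈ε⇒x≈y)
  expand : ∀ p q r → p *ₚ (q +ₚ -ₚ r) ≈ₚ p *ₚ q +ₚ -ₚ (p *ₚ r)
  expand = solve-∀ polyACR

-- The field ℚ(t)

≃-refl : ∀ {x} → x ≃ x
≃-refl = cross ≈ₚ.refl

≃-sym : ∀ {x y} → x ≃ y → y ≃ x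
≃-sym (cross e) = cross (≈ₚ.sym e)

≃-trans : ∀ {x y z} → x ≃ y → y ≃ z → x ≃ z
≃-trans {x} {y} {z} (cross e) (cross f) = cross (*ₚ-cancelˡ (den-nonZero y) (begin
  den y *ₚ (num x *ₚ den z)  ≈⟨ swap (den y) (num x) (den z) ⟩
  num x *ₚ den y *ₚ den z    ≈⟨ *ₚ-cong e ≈ₚ.refl ⟩
  num y *ₚ den x *ₚ den z    ≈⟨ swap′ (num y) (den x) (den z) ⟩
  num y *ₚ den z *ₚ den x    ≈⟨ *ₚ-cong f ≈ₚ.refl ⟩
  num z *ₚ den y *ₚ den x    ≈⟨ swap″ (num z) (den y) (den x) ⟩
  den y *ₚ (num z *ₚ den x)  ∎))
  where
  open SetoidReasoning polySetoid
  swap : ∀ d a c → d *ₚ (a *ₚ c) ≈ₚ a *ₚ d *ₚ c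
  swap = solve-∀ polyACR
  swap′ : ∀ a b c → a *ₚ b *ₚ c ≈ₚ a *ₚ c *ₚ b
  swap′ = solve-∀ polyACR
  swap″ : ∀ a d c → a *ₚ d *ₚ c ≈ₚ d *ₚ (a *ₚ c)
  swap″ = solve-∀ polyACR

+-cong : ∀ {x x′ y y′} → x ≃ x′ → y ≃ y′ → x + y ≃ x′ + y′
+-cong {x} {x′} {y} {y′} (cross e) (cross f) = cross (begin
  (a *ₚ d +ₚ c *ₚ b) *ₚ (b′ *ₚ d′)
    ≈⟨ regroup a b c d b′ d′ ⟩
  a *ₚ b′ *ₚ (d *ₚ d′) +ₚ c *ₚ d′ *ₚ (b *ₚ b′)
    ≈⟨ +ₚ-cong (*ₚ-cong e ≈ₚ.refl) (*ₚ-cong f ≈ₚ.refl) ⟩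
  a′ *ₚ b *ₚ (d *ₚ d′) +ₚ c′ *ₚ d *ₚ (b *ₚ b′)
    ≈⟨ regroup′ a′ b c′ d b′ d′ ⟩
  (a′ *ₚ d′ +ₚ c′ *ₚ b′) *ₚ (b *ₚ d)
    ∎)
  where
  open SetoidReasoning polySetoid
  a  = num x  ; b  = den x  ; c  = num y  ; d  = den y
  a′ = num x′ ; b′ = den x′ ; c′ = num y′ ; d′ = den y′
  regroup : ∀ a b c d b′ d′ → (a *ₚ d +ₚ c *ₚ b) *ₚ (b′ *ₚ d′)
            ≈ₚ a *ₚ b′ *ₚ (d *ₚ d′) +ₚ c *ₚ d′ *ₚ (b *ₚ b′)
  regroup = solve-∀ polyACR
  regroup′ : ∀ a b c d b′ d′ → a *ₚ b *ₚ (d *ₚ d′) +ₚ c *ₚ d *ₚ (b *ₚ b′)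
             ≈ₚ (a *ₚ d′ +ₚ c *ₚ b′) *ₚ (b *ₚ d)
  regroup′ = solve-∀ polyACR

*-cong : ∀ {x x′ y y′} → x ≃ x′ → y ≃ y′ → x * y ≃ x′ * y′
*-cong {x} {x′} {y} {y′} (cross e) (cross f) = cross (begin
  (num x *ₚ num y) *ₚ (den x′ *ₚ den y′)  ≈⟨ interchange (num x) (num y) (den x′) (den y′) ⟩
  (num x *ₚ den x′) *ₚ (num y *ₚ den y′)  ≈⟨ *ₚ-cong e f ⟩
  (num x′ *ₚ den x) *ₚ (num y′ *ₚ den y)  ≈⟨ interchange (num x′) (den x) (num y′) (den y) ⟩
  (num x′ *ₚ num y′) *ₚ (den x *ₚ den y)  ∎)
  where
  open SetoidReasoning polySetoid
  interchange : ∀ a b c d → (a *ₚ b) *ₚ (c *ₚ d) ≈ₚ (a *ₚ c) *ₚ (b *ₚ d)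
  interchange = solve-∀ polyACR

-‿cong : ∀ {x y} → x ≃ y → - x ≃ - y
-‿cong {x} {y} (cross e) = cross (begin
  (-ₚ num x) *ₚ den y    ≈⟨ pull (num x) (den y) ⟩
  -ₚ (num x *ₚ den y)    ≈⟨ -ₚ-cong e ⟩
  -ₚ (num y *ₚ den x)    ≈⟨ pull (num y) (den x) ⟨
  (-ₚ num y) *ₚ den x    ∎)
  where
  open SetoidReasoning polySetoid
  pull : ∀ a b → (-ₚ a) *ₚ b ≈ₚ -ₚ (a *ₚ b)
  pull = solve-∀ polyACR

+-assoc : ∀ x y z → (x + y) + z ≃ x + (y + z)
+-assoc x y z = cross (go (num x) (den x) (num y) (den y) (num z) (den z))
  where
  go : ∀ a b c d e f →
       ((a *ₚ d +ₚ c *ₚ b) *ₚ f +ₚ e *ₚ (b *ₚ d)) *ₚ (b *ₚ (d *ₚ f))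
       ≈ₚ (a *ₚ (d *ₚ f) +ₚ (c *ₚ f +ₚ e *ₚ d) *ₚ b) *ₚ ((b *ₚ d) *ₚ f)
  go = solve-∀ polyACR

+-comm : ∀ x y → x + y ≃ y + x
+-comm x y = cross (go (num x) (den x) (num y) (den y))
  where
  go : ∀ a b c d → (a *ₚ d +ₚ c *ₚ b) *ₚ (d *ₚ b) ≈ₚ (c *ₚ b +ₚ a *ₚ d) *ₚ (b *ₚ d)
  go = solve-∀ polyACR

+-identityʳ : ∀ x → x + 0# ≃ x
+-identityʳ x = cross (≈ₚ.trans (*ₚ-cong {q = den x} (+ₚ-identityʳ (num x *ₚ (1ℚ ∷ []))) ≈ₚ.refl)
                                (go (num x) (den x) (1ℚ ∷ [])))
  where
  go : ∀ a b e → (a *ₚ e) *ₚ b ≈ₚ a *ₚ (b *ₚ e)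
  go = solve-∀ polyACR

-‿inverseʳ : ∀ x → x + - x ≃ 0#
-‿inverseʳ x = cross (*ₚ-cong (begin
  num x *ₚ den x +ₚ (-ₚ num x) *ₚ den x  ≈⟨ *ₚ-distribʳ (den x) (num x) (-ₚ num x) ⟨
  (num x +ₚ -ₚ num x) *ₚ den x           ≈⟨ *ₚ-cong (-ₚ-inverseʳ (num x)) ≈ₚ.refl ⟩
  []                                     ∎) (≈ₚ.refl {1ℚ ∷ []}))
  where open SetoidReasoning polySetoid

*-assoc : ∀ x y z → (x * y) * z ≃ x * (y * z)
*-assoc x y z = cross (go (num x) (den x) (num y) (den y) (num z) (den z))
  where
  go : ∀ a b c d e f →
       ((a *ₚ c) *ₚ e) *ₚ (b *ₚ (d *ₚ f)) ≈ₚ (a *ₚ (c *ₚ e)) *ₚ ((b *ₚ d) *ₚ f)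
  go = solve-∀ polyACR

*-comm : ∀ x y → x * y ≃ y * x
*-comm x y = cross (go (num x) (den x) (num y) (den y))
  where
  go : ∀ a b c d → (a *ₚ c) *ₚ (d *ₚ b) ≈ₚ (c *ₚ a) *ₚ (b *ₚ d)
  go = solve-∀ polyACR

*-identityˡ : ∀ x → 1# * x ≃ x
*-identityˡ x = cross (go (1ℚ ∷ []) (num x) (den x))
  where
  go : ∀ e a b → (e *ₚ a) *ₚ b ≈ₚ a *ₚ (e *ₚ b)
  go = solve-∀ polyACR

*-distribˡ-+ : ∀ x y z → x * (y + z) ≃ x * y + x * z
*-distribˡ-+ x y z = cross (go (num x) (den x) (num y) (den y) (num z) (den z))
  where
  go : ∀ a b c d e f →
       (a *ₚ (c *ₚ f +ₚ e *ₚ d)) *ₚ ((b *ₚ d) *ₚ (b *ₚ f))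
       ≈ₚ ((a *ₚ c) *ₚ (b *ₚ f) +ₚ (a *ₚ e) *ₚ (b *ₚ d)) *ₚ (b *ₚ (d *ₚ f))
  go = solve-∀ polyACR

ratFunRing : CommutativeRing 0ℓ 0ℓ
ratFunRing = record
  { Carrier = RatFun
  ; _≈_ = _≃_
  ; _+_ = _+_
  ; _*_ = _*_
  ; -_  = -_
  ; 0#  = 0#
  ; 1#  = 1#
  ; isCommutativeRing = record
    { isRing = record
      { +-isAbelianGroup = record
        { isGroup = record
          { isMonoid = record
            { isSemigroup = record
              { isMagma = record
                { isEquivalence = record { refl = ≃-refl ; sym = ≃-sym ; trans = ≃-trans }
                ; ∙-cong = +-cong
                }
              ; assoc = +-assoc
              }
            ; identity = (λ x → ≃-trans (+-comm 0# x) (+-identityʳ x)) , +-identityʳ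
            }
          ; inverse = (λ x → ≃-trans (+-comm (- x) x) (-‿inverseʳ x)) , -‿inverseʳ
          ; ⁻¹-cong = -‿cong
          }
        ; comm = +-comm
        }
      ; *-cong = *-cong
      ; *-assoc = *-assoc
      ; *-identity = *-identityˡ , λ x → ≃-trans (*-comm x 1#) (*-identityˡ x)
      ; distrib = *-distribˡ-+
                , λ x y z → ≃-trans (*-comm (y + z) x)
                    (≃-trans (*-distribˡ-+ x y z) (+-cong (*-comm x y) (*-comm x z)))
      }
    ; *-comm = *-comm
    }
  }

module ℚ⟨t⟩ = CommutativeRing ratFunRing

open Exp ℚ⟨t⟩.semiring using (^-homo-*; ^-assocʳ; ^-congˡ; ^-congʳ)

module ≃-Reasoning = SetoidReasoning ℚ⟨t⟩.setoid

ratFunACR : AlmostCommutativeRing 0ℓ 0ℓ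
ratFunACR = fromCommutativeRing ratFunRing λ _ → nothing

-- Neither factor of a product nor summand of a sum can be inferred from it,
-- because _+_ and _*_ are defined functions; hence the explicit arguments.

+-congˡ : ∀ x {y z} → y ≃ z → x + y ≃ x + z
+-congˡ x = +-cong (≃-refl {x})

+-congʳ : ∀ x {y z} → y ≃ z → y + x ≃ z + x
+-congʳ x e = +-cong e (≃-refl {x})

*-congˡ : ∀ x {y z} → y ≃ z → x * y ≃ x * z
*-congˡ x = *-cong (≃-refl {x})

*-congʳ : ∀ x {y z} → y ≃ z → y * x ≃ z * x
*-congʳ x e = *-cong e (≃-refl {x})

*-interchange : ∀ a b c d → a * b * (c * d) ≃ a * c * (b * d)
*-interchange = solve-∀ ratFunACR

-- Nonzero elements of ℚ(t), up to equality of fractions.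

NonZero : RatFun → Set
NonZero x = ¬ (x ≃ 0#)

≃0⇒num≈0 : ∀ {x} → x ≃ 0# → num x ≈ₚ []
≃0⇒num≈0 {x} (cross e) = ≈ₚ.trans (≈ₚ.sym (*ₚ-identityʳ (num x))) e

num≈0⇒≃0 : ∀ {x} → num x ≈ₚ [] → x ≃ 0#
num≈0⇒≃0 {x} e = cross (≈ₚ.trans (*ₚ-identityʳ (num x)) e)

⁻¹-inverseʳ : ∀ {x} → NonZero x → x * x ⁻¹ ≃ 1#
⁻¹-inverseʳ {x} x≄0 with zero? (num x)
... | yes p≈0 = contradiction (num≈0⇒≃0 p≈0) x≄0
... | no  _   = cross (go (num x) (den x) (1ℚ ∷ []))
  where
  go : ∀ a b e → (a *ₚ b) *ₚ e ≈ₚ e *ₚ (b *ₚ a)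
  go = solve-∀ polyACR

÷-* : ∀ x {y} → NonZero y → (x ÷ y) * y ≃ x
÷-* x {y} y≄0 = begin
  x * y ⁻¹ * y    ≈⟨ swap x y (y ⁻¹) ⟩
  x * (y * y ⁻¹)  ≈⟨ *-congˡ x (⁻¹-inverseʳ y≄0) ⟩
  x * 1#          ≈⟨ ℚ⟨t⟩.*-identityʳ x ⟩
  x               ∎
  where
  open ≃-Reasoning
  swap : ∀ x y z → x * z * y ≃ x * (y * z)
  swap = solve-∀ ratFunACR

*-÷ : ∀ x {y} → NonZero y → (x * y) ÷ y ≃ x
*-÷ x {y} y≄0 = begin
  x * y * y ⁻¹    ≈⟨ *-assoc x y (y ⁻¹) ⟩
  x * (y * y ⁻¹)  ≈⟨ *-congˡ x (⁻¹-inverseʳ y≄0) ⟩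
  x * 1#          ≈⟨ ℚ⟨t⟩.*-identityʳ x ⟩
  x               ∎
  where open ≃-Reasoning

*-cancelʳ : ∀ {x y z} → NonZero z → x * z ≃ y * z → x ≃ y
*-cancelʳ {x} {y} {z} z≄0 e = begin
  x            ≈⟨ *-÷ x z≄0 ⟨
  (x * z) ÷ z  ≈⟨ *-congʳ (z ⁻¹) e ⟩
  (y * z) ÷ z  ≈⟨ *-÷ y z≄0 ⟩
  y            ∎
  where open ≃-Reasoning

-- The embedding of ℚ[t]

polynomial-cong : ∀ {p q} → p ≈ₚ q → polynomial p ≃ polynomial q
polynomial-cong e = cross (*ₚ-cong e ≈ₚ.refl)

polynomial-injective : ∀ {p q} → polynomial p ≃ polynomial q → p ≈ₚ q
polynomial-injective {p} {q} (cross e) =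
  ≈ₚ.trans (≈ₚ.sym (*ₚ-identityʳ p)) (≈ₚ.trans e (*ₚ-identityʳ q))

polynomial-+ : ∀ p q → polynomial (p +ₚ q) ≃ polynomial p + polynomial q
polynomial-+ p q = cross (go p q (1ℚ ∷ []))
  where
  go : ∀ p q e → (p +ₚ q) *ₚ (e *ₚ e) ≈ₚ (p *ₚ e +ₚ q *ₚ e) *ₚ e
  go = solve-∀ polyACR

polynomial-* : ∀ p q → polynomial (p *ₚ q) ≃ polynomial p * polynomial q
polynomial-* p q = cross (*ₚ-congˡ (p *ₚ q) (*ₚ-identityʳ (1ℚ ∷ [])))

const-* : ∀ a b → const (a ℚ.* b) ≃ const a * const b
const-* a b = ≃-trans (polynomial-cong (∷-congₚ (≡.sym (ℚ.+-identityʳ (a ℚ.* b))) ≈ₚ.refl))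
                      (polynomial-* (a ∷ []) (b ∷ []))

polynomial-∷ : ∀ a p → polynomial (a ∷ p) ≃ const a + t * polynomial p
polynomial-∷ a p = begin
  polynomial (a ∷ p)
    ≈⟨ polynomial-cong split ⟩
  polynomial ((a ∷ []) +ₚ (0ℚ ∷ 1ℚ ∷ []) *ₚ p)
    ≈⟨ polynomial-+ (a ∷ []) ((0ℚ ∷ 1ℚ ∷ []) *ₚ p) ⟩
  const a + polynomial ((0ℚ ∷ 1ℚ ∷ []) *ₚ p)
    ≈⟨ +-congˡ (const a) (polynomial-* (0ℚ ∷ 1ℚ ∷ []) p) ⟩
  const a + t * polynomial p
    ∎
  where
  open ≃-Reasoning
  split : a ∷ p ≈ₚ (a ∷ []) +ₚ (0ℚ ∷ 1ℚ ∷ []) *ₚ p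
  split = ≈ₚ.sym (≈ₚ.trans
    (+ₚ-cong {a ∷ []} ≈ₚ.refl (≈ₚ.trans (0∷-*ₚ (1ℚ ∷ []) p) (∷-congₚ ≡.refl (*ₚ-identityˡ p))))
    (∷-congₚ (ℚ.+-identityʳ a) ≈ₚ.refl))

-- Evaluation of polynomials

module Evaluation (x : RatFun) where

  -- The homomorphism ℚ[t] → ℚ(t) sending t to x.

  eval : Poly → RatFun
  eval p = evalₚ p x

  eval-zero : ∀ p → p ≈ₚ [] → eval p ≃ 0#
  eval-zero []      e = ≃-refl
  eval-zero (a ∷ p) e = begin
    const a + x * eval p  ≈⟨ +-cong const≃0 (*-congˡ x (eval-zero p (coeffwise λ i → coeff-≡ e (suc i)))) ⟩
    0# + x * 0#           ≈⟨ +-congˡ 0# (ℚ⟨t⟩.zeroʳ x) ⟩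
    0# + 0#               ≈⟨ +-identityʳ 0# ⟩
    0#                    ∎
    where
    open ≃-Reasoning
    const≃0 : const a ≃ 0#
    const≃0 = polynomial-cong (≈ₚ.trans (∷-congₚ (coeff-≡ e 0) (≈ₚ.refl {[]})) 0∷[])

  eval-cong : ∀ {p q} → p ≈ₚ q → eval p ≃ eval q
  eval-cong {[]}    {q}     e = ≃-sym (eval-zero q (≈ₚ.sym e))
  eval-cong {a ∷ p} {[]}    e = eval-zero (a ∷ p) e
  eval-cong {a ∷ p} {b ∷ q} e =
    +-cong (polynomial-cong (∷-congₚ (coeff-≡ e 0) (≈ₚ.refl {[]})))
           (*-congˡ x (eval-cong {p} {q} (coeffwise λ i → coeff-≡ e (suc i))))

  eval-+ : ∀ p q → eval (p +ₚ q) ≃ eval p + eval q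
  eval-+ []      q       = ≃-sym (ℚ⟨t⟩.+-identityˡ (eval q))
  eval-+ (a ∷ p) []      = ≃-sym (+-identityʳ (eval (a ∷ p)))
  eval-+ (a ∷ p) (b ∷ q) = begin
    const (a ℚ.+ b) + x * eval (p +ₚ q)
      ≈⟨ +-cong (polynomial-+ (a ∷ []) (b ∷ [])) (*-congˡ x (eval-+ p q)) ⟩
    (const a + const b) + x * (eval p + eval q)
      ≈⟨ regroup (const a) (const b) x (eval p) (eval q) ⟩
    (const a + x * eval p) + (const b + x * eval q)
      ∎
    where
    open ≃-Reasoning
    regroup : ∀ a b x p q → (a + b) + x * (p + q) ≃ (a + x * p) + (b + x * q)
    regroup = solve-∀ ratFunACR

  eval-·ₚ : ∀ a p → eval (a ·ₚ p) ≃ const a * eval p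
  eval-·ₚ a []      = ≃-sym (ℚ⟨t⟩.zeroʳ (const a))
  eval-·ₚ a (b ∷ p) = begin
    const (a ℚ.* b) + x * eval (a ·ₚ p)
      ≈⟨ +-cong (const-* a b) (*-congˡ x (eval-·ₚ a p)) ⟩
    const a * const b + x * (const a * eval p)
      ≈⟨ regroup (const a) (const b) x (eval p) ⟩
    const a * (const b + x * eval p)
      ∎
    where
    open ≃-Reasoning
    regroup : ∀ a b x p → a * b + x * (a * p) ≃ a * (b + x * p)
    regroup = solve-∀ ratFunACR

  eval-const : ∀ a → eval (a ∷ []) ≃ const a
  eval-const a = ≃-trans (+-congˡ (const a) (ℚ⟨t⟩.zeroʳ x)) (+-identityʳ (const a))

  eval-0∷ : ∀ p → eval (0ℚ ∷ p) ≃ x * eval p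
  eval-0∷ p = ≃-trans (+-congʳ (x * eval p) (polynomial-cong 0∷[])) (ℚ⟨t⟩.+-identityˡ (x * eval p))

  eval-* : ∀ p q → eval (p *ₚ q) ≃ eval p * eval q
  eval-* []      q = ≃-sym (ℚ⟨t⟩.zeroˡ (eval q))
  eval-* (a ∷ p) q = begin
    eval (a ·ₚ q +ₚ (0ℚ ∷ p *ₚ q))
      ≈⟨ eval-+ (a ·ₚ q) (0ℚ ∷ p *ₚ q) ⟩
    eval (a ·ₚ q) + eval (0ℚ ∷ p *ₚ q)
      ≈⟨ +-cong (eval-·ₚ a q) (≃-trans (eval-0∷ (p *ₚ q)) (*-congˡ x (eval-* p q))) ⟩
    const a * eval q + x * (eval p * eval q)
      ≈⟨ regroup (const a) x (eval p) (eval q) ⟩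
    (const a + x * eval p) * eval q
      ∎
    where
    open ≃-Reasoning
    regroup : ∀ a x p q → a * q + x * (p * q) ≃ (a + x * p) * q
    regroup = solve-∀ ratFunACR

-- The substitution t ↦ t⁻¹

-- From here on, eval p is p(t⁻¹).

open Evaluation (t ⁻¹)

t-nonZero : NonZero t
t-nonZero t≃0 = contradiction (coeff-≡ (≃0⇒num≈0 t≃0) 1) λ ()

t*t⁻¹ : t * t ⁻¹ ≃ 1#
t*t⁻¹ = ⁻¹-inverseʳ t-nonZero

ʳ++-zero : ∀ q p → q ʳ++ p ≈ₚ [] → q ≈ₚ [] × p ≈ₚ []
ʳ++-zero []      p e = ≈ₚ.refl , e
ʳ++-zero (a ∷ q) p e with q≈0 , ap≈0 ← ʳ++-zero q (a ∷ p) e =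
  ≈ₚ.trans (∷-congₚ (coeff-≡ ap≈0 0) q≈0) 0∷[] ,
  coeffwise λ i → coeff-≡ ap≈0 (suc i)

-- Prepending the reversal of q to p gives rev(q) + t^|q| p, where |q| is the
-- length of the list q and rev(q) = t^(|q| - 1) q(t⁻¹).  The factor t⁻¹ on
-- the right avoids the exponent |q| - 1, which is negative for q = [].

polynomial-ʳ++ : ∀ q p →
  polynomial (q ʳ++ p) ≃ t ^ length q * (polynomial p + t ⁻¹ * eval q)
polynomial-ʳ++ []      p = ≃-sym (begin
  1# * (polynomial p + t ⁻¹ * 0#)  ≈⟨ *-identityˡ _ ⟩
  polynomial p + t ⁻¹ * 0#         ≈⟨ +-congˡ (polynomial p) (ℚ⟨t⟩.zeroʳ (t ⁻¹)) ⟩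
  polynomial p + 0#                ≈⟨ +-identityʳ (polynomial p) ⟩
  polynomial p                     ∎)
  where open ≃-Reasoning
polynomial-ʳ++ (a ∷ q) p = begin
  polynomial (q ʳ++ (a ∷ p))
    ≈⟨ polynomial-ʳ++ q (a ∷ p) ⟩
  t ^ length q * (polynomial (a ∷ p) + t ⁻¹ * eval q)
    ≈⟨ *-congˡ c (+-congʳ (t ⁻¹ * eval q) (polynomial-∷ a p)) ⟩
  c * (const a + t * polynomial p + t ⁻¹ * eval q)
    ≈⟨ *-congˡ c (collect (const a) (t * polynomial p) (t ⁻¹ * eval q)) ⟩
  c * (t * polynomial p + (const a + t ⁻¹ * eval q))
    ≈⟨ *-congˡ c (+-congˡ (t * polynomial p) (*-identityˡ (eval (a ∷ q)))) ⟨
  c * (t * polynomial p + 1# * eval (a ∷ q))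
    ≈⟨ *-congˡ c (+-congˡ (t * polynomial p) (*-congʳ (eval (a ∷ q)) t*t⁻¹)) ⟨
  c * (t * polynomial p + t * t ⁻¹ * eval (a ∷ q))
    ≈⟨ regroup c t (t ⁻¹) (polynomial p) (eval (a ∷ q)) ⟩
  t * c * (polynomial p + t ⁻¹ * eval (a ∷ q))
    ∎
  where
  open ≃-Reasoning
  c : RatFun
  c = t ^ length q
  collect : ∀ a z y → a + z + y ≃ z + (a + y)
  collect = solve-∀ ratFunACR
  regroup : ∀ c t s p y → c * (t * p + t * s * y) ≃ t * c * (p + s * y)
  regroup = solve-∀ ratFunACR

-- If q(t⁻¹) = 0, then the reversal of q is zero, and so is q.

eval-nonZero : ∀ {q} → NonZeroₚ q → NonZero (eval q)
eval-nonZero {q} q≉0 eq≃0 = q≉0 (proj₁ (ʳ++-zero q [] (≃0⇒num≈0 (begin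
  polynomial (q ʳ++ [])                ≈⟨ polynomial-ʳ++ q [] ⟩
  t ^ length q * (0# + t ⁻¹ * eval q)  ≈⟨ *-congˡ (t ^ length q) (+-congˡ 0# (*-congˡ (t ⁻¹) eq≃0)) ⟩
  t ^ length q * (0# + t ⁻¹ * 0#)      ≈⟨ *-congˡ (t ^ length q) (≃-trans (ℚ⟨t⟩.+-identityˡ (t ⁻¹ * 0#)) (ℚ⟨t⟩.zeroʳ (t ⁻¹))) ⟩
  t ^ length q * 0#                    ≈⟨ ℚ⟨t⟩.zeroʳ (t ^ length q) ⟩
  0#                                   ∎))))
  where open ≃-Reasoning

-- The substitution t ↦ t⁻¹ on ℚ(t).

σ : RatFun → RatFun
σ f = f ⟨ t ⁻¹ ⟩

eval-den-nonZero : ∀ f → NonZero (eval (den f))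
eval-den-nonZero f = eval-nonZero (den-nonZero f)

σ*den : ∀ f → σ f * eval (den f) ≃ eval (num f)
σ*den f = ÷-* (eval (num f)) (eval-den-nonZero f)

-- σ f is determined by σ f · d(t⁻¹) = n(t⁻¹) for f = n/d.  The homomorphism
-- laws for σ reduce to those for eval by this characterisation.

σ-unique : ∀ f {y} → y * eval (den f) ≃ eval (num f) → σ f ≃ y
σ-unique f e = *-cancelʳ (eval-den-nonZero f) (≃-trans (σ*den f) (≃-sym e))

σ-cong : ∀ {f g} → f ≃ g → σ f ≃ σ g
σ-cong {f} {g} (cross e) = σ-unique f (*-cancelʳ (eval-den-nonZero g) (begin
  σ g * eval (den f) * eval (den g)    ≈⟨ swap (σ g) (eval (den f)) (eval (den g)) ⟩
  σ g * eval (den g) * eval (den f)    ≈⟨ *-congʳ (eval (den f)) (σ*den g) ⟩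
  eval (num g) * eval (den f)          ≈⟨ eval-* (num g) (den f) ⟨
  eval (num g *ₚ den f)                ≈⟨ eval-cong (≈ₚ.sym e) ⟩
  eval (num f *ₚ den g)                ≈⟨ eval-* (num f) (den g) ⟩
  eval (num f) * eval (den g)          ∎))
  where
  open ≃-Reasoning
  swap : ∀ a b c → a * b * c ≃ a * c * b
  swap = solve-∀ ratFunACR

σ-+ : ∀ f g → σ (f + g) ≃ σ f + σ g
σ-+ f g = σ-unique (f + g) (begin
  (σ f + σ g) * eval (den f *ₚ den g)
    ≈⟨ *-congˡ (σ f + σ g) (eval-* (den f) (den g)) ⟩
  (σ f + σ g) * (eval (den f) * eval (den g))
    ≈⟨ regroup (σ f) (σ g) (eval (den f)) (eval (den g)) ⟩
  σ f * eval (den f) * eval (den g) + σ g * eval (den g) * eval (den f)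
    ≈⟨ +-cong (*-congʳ (eval (den g)) (σ*den f)) (*-congʳ (eval (den f)) (σ*den g)) ⟩
  eval (num f) * eval (den g) + eval (num g) * eval (den f)
    ≈⟨ +-cong (eval-* (num f) (den g)) (eval-* (num g) (den f)) ⟨
  eval (num f *ₚ den g) + eval (num g *ₚ den f)
    ≈⟨ eval-+ (num f *ₚ den g) (num g *ₚ den f) ⟨
  eval (num f *ₚ den g +ₚ num g *ₚ den f)
    ∎)
  where
  open ≃-Reasoning
  regroup : ∀ x y a b → (x + y) * (a * b) ≃ x * a * b + y * b * a
  regroup = solve-∀ ratFunACR

σ-* : ∀ f g → σ (f * g) ≃ σ f * σ g
σ-* f g = σ-unique (f * g) (begin
  σ f * σ g * eval (den f *ₚ den g)
    ≈⟨ *-congˡ (σ f * σ g) (eval-* (den f) (den g)) ⟩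
  σ f * σ g * (eval (den f) * eval (den g))
    ≈⟨ *-interchange (σ f) (σ g) (eval (den f)) (eval (den g)) ⟩
  σ f * eval (den f) * (σ g * eval (den g))
    ≈⟨ *-cong (σ*den f) (σ*den g) ⟩
  eval (num f) * eval (num g)
    ≈⟨ eval-* (num f) (num g) ⟨
  eval (num f *ₚ num g)
    ∎)
  where open ≃-Reasoning

σ-polynomial : ∀ p → σ (polynomial p) ≃ eval p
σ-polynomial p = σ-unique (polynomial p)
  (≃-trans (*-congˡ (eval p) (eval-const 1ℚ)) (ℚ⟨t⟩.*-identityʳ (eval p)))

σ-const : ∀ a → σ (const a) ≃ const a
σ-const a = ≃-trans (σ-polynomial (a ∷ [])) (eval-const a)

σ-t : σ t ≃ t ⁻¹
σ-t = begin
  σ t                     ≈⟨ σ-polynomial (0ℚ ∷ 1ℚ ∷ []) ⟩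
  eval (0ℚ ∷ 1ℚ ∷ [])     ≈⟨ eval-0∷ (1ℚ ∷ []) ⟩
  t ⁻¹ * eval (1ℚ ∷ [])   ≈⟨ *-congˡ (t ⁻¹) (eval-const 1ℚ) ⟩
  t ⁻¹ * 1#               ≈⟨ ℚ⟨t⟩.*-identityʳ (t ⁻¹) ⟩
  t ⁻¹                    ∎
  where open ≃-Reasoning

σ-^ : ∀ f n → σ (f ^ n) ≃ σ f ^ n
σ-^ f zero    = σ-const 1ℚ
σ-^ f (suc n) = ≃-trans (σ-* f (f ^ n)) (*-congˡ (σ f) (σ-^ f n))

σ-1-^ : ∀ f n → σ (1# - f ^ n) ≃ 1# - σ f ^ n
σ-1-^ f n = begin
  σ (1# - f ^ n)             ≈⟨ σ-+ 1# (- f ^ n) ⟩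
  σ 1# + σ (- f ^ n)         ≈⟨ +-cong (σ-const 1ℚ) (σ-cong (≃-sym (-1*x≈-x (f ^ n)))) ⟩
  1# + σ (- 1# * f ^ n)      ≈⟨ +-congˡ 1# (σ-* (- 1#) (f ^ n)) ⟩
  1# + σ (- 1#) * σ (f ^ n)  ≈⟨ +-congˡ 1# (*-cong (σ-const (ℚ.- 1ℚ)) (σ-^ f n)) ⟩
  1# + - 1# * σ f ^ n        ≈⟨ +-congˡ 1# (-1*x≈-x (σ f ^ n)) ⟩
  1# - σ f ^ n               ∎
  where
  open ≃-Reasoning
  open RingProperties ℚ⟨t⟩.ring using (-1*x≈-x)

-- Homogeneous elements

palindromic-cong : ∀ {d x y} → x ≃ y → PalindromicOfDarga d x → PalindromicOfDarga d y
palindromic-cong {d} {x} {y} x≃y e = begin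
  y            ≈⟨ x≃y ⟨
  x            ≈⟨ e ⟩
  t ^ d * σ x  ≈⟨ *-congˡ (t ^ d) (σ-cong x≃y) ⟩
  t ^ d * σ y  ∎
  where open ≃-Reasoning

palindromic-+ : ∀ {d x y} → PalindromicOfDarga d x → PalindromicOfDarga d y →
                PalindromicOfDarga d (x + y)
palindromic-+ {d} {x} {y} e f = begin
  x + y                      ≈⟨ +-cong e f ⟩
  t ^ d * σ x + t ^ d * σ y  ≈⟨ *-distribˡ-+ (t ^ d) (σ x) (σ y) ⟨
  t ^ d * (σ x + σ y)        ≈⟨ *-congˡ (t ^ d) (σ-+ x y) ⟨
  t ^ d * σ (x + y)          ∎
  where open ≃-Reasoning

palindromic-* : ∀ {d e x y} → PalindromicOfDarga d x → PalindromicOfDarga e y →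
                PalindromicOfDarga (d ℕ.+ e) (x * y)
palindromic-* {d} {e} {x} {y} f g = begin
  x * y                          ≈⟨ *-cong f g ⟩
  t ^ d * σ x * (t ^ e * σ y)    ≈⟨ *-interchange (t ^ d) (σ x) (t ^ e) (σ y) ⟩
  t ^ d * t ^ e * (σ x * σ y)    ≈⟨ *-cong (^-homo-* t d e) (σ-* x y) ⟨
  t ^ (d ℕ.+ e) * σ (x * y)      ∎
  where open ≃-Reasoning

palindromic-const : ∀ a → PalindromicOfDarga 0 (const a)
palindromic-const a = ≃-sym (≃-trans (*-identityˡ (σ (const a))) (σ-const a))

palindromic-0# : ∀ d → PalindromicOfDarga d 0#
palindromic-0# d =
  ≃-sym (≃-trans (*-congˡ (t ^ d) (σ-polynomial [])) (ℚ⟨t⟩.zeroʳ (t ^ d)))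

isPolynomial-cong : ∀ {x y} → x ≃ y → IsPolynomial x → IsPolynomial y
isPolynomial-cong x≃y (p , e) = p , ≃-trans (≃-sym x≃y) e

isPolynomial-+ : ∀ {x y} → IsPolynomial x → IsPolynomial y → IsPolynomial (x + y)
isPolynomial-+ (p , e) (q , f) = p +ₚ q , ≃-trans (+-cong e f) (≃-sym (polynomial-+ p q))

isPolynomial-* : ∀ {x y} → IsPolynomial x → IsPolynomial y → IsPolynomial (x * y)
isPolynomial-* (p , e) (q , f) = p *ₚ q , ≃-trans (*-cong e f) (≃-sym (polynomial-* p q))

isPolynomial-^ : ∀ {x} → IsPolynomial x → ∀ n → IsPolynomial (x ^ n)
isPolynomial-^ e zero    = (1ℚ ∷ []) , ≃-refl
isPolynomial-^ e (suc n) = isPolynomial-* e (isPolynomial-^ e n)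

-- Homogeneity of weight n: a polynomial, palindromic of darga k n.  The
-- parameter k stands for M - 1.

record Homogeneous (k n : ℕ) (x : RatFun) : Set where
  constructor homogeneous
  field
    isPolynomial : IsPolynomial x
    palindromic  : PalindromicOfDarga (k ℕ.* n) x

open Homogeneous

module _ {k : ℕ} where

  homogeneous-cong : ∀ {n x y} → x ≃ y → Homogeneous k n x → Homogeneous k n y
  homogeneous-cong x≃y (homogeneous p e) =
    homogeneous (isPolynomial-cong x≃y p) (palindromic-cong {k ℕ.* _} x≃y e)

  homogeneous-0# : ∀ {n} → Homogeneous k n 0#
  homogeneous-0# {n} = homogeneous ([] , ≃-refl) (palindromic-0# (k ℕ.* n))

  homogeneous-const : ∀ a → Homogeneous k 0 (const a)
  homogeneous-const a = homogeneous ((a ∷ []) , ≃-refl)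
    (≡.subst (λ d → PalindromicOfDarga d (const a)) (≡.sym (ℕ.*-zeroʳ k)) (palindromic-const a))

  homogeneous-+ : ∀ {n x y} → Homogeneous k n x → Homogeneous k n y → Homogeneous k n (x + y)
  homogeneous-+ {n} (homogeneous p e) (homogeneous q f) =
    homogeneous (isPolynomial-+ p q) (palindromic-+ {k ℕ.* n} e f)

  homogeneous-* : ∀ {i j x y} → Homogeneous k i x → Homogeneous k j y →
                  Homogeneous k (i ℕ.+ j) (x * y)
  homogeneous-* {i} {j} {x} {y} (homogeneous p e) (homogeneous q f) =
    homogeneous (isPolynomial-* p q)
      (≡.subst (λ d → PalindromicOfDarga d (x * y)) (≡.sym (ℕ.*-distribˡ-+ k i j))
        (palindromic-* {k ℕ.* i} {k ℕ.* j} e f))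

  homogeneous-scale : ∀ a {n x} → Homogeneous k n x → Homogeneous k n (const a * x)
  homogeneous-scale a = homogeneous-* (homogeneous-const a)

  homogeneous-sum : ∀ {n} m {v : Fin m → RatFun} →
                    (∀ i → Homogeneous k n (v i)) → Homogeneous k n (sum {m} v)
  homogeneous-sum zero    h = homogeneous-0#
  homogeneous-sum (suc m) h = homogeneous-+ (h zero) (homogeneous-sum m (λ i → h (suc i)))

-- The coefficient of u^n is homogeneous of weight n, for every n.

HomogeneousSeries : ℕ → Series → Set
HomogeneousSeries k G = ∀ n → Homogeneous k n (G n)

module _ {k : ℕ} where

  homogeneous-*ₛ : ∀ {G H} → HomogeneousSeries k G → HomogeneousSeries k H →
                   HomogeneousSeries k (G *ₛ H)
  homogeneous-*ₛ {G} {H} g h n = homogeneous-sum (suc n) λ i →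
    ≡.subst (λ m → Homogeneous k m (G (toℕ i) * H (n ∸ toℕ i)))
      (ℕ.m+[n∸m]≡n (toℕ≤pred[n] i))
      (homogeneous-* (g (toℕ i)) (h (n ∸ toℕ i)))

  homogeneous-^ₛ : ∀ {G} → HomogeneousSeries k G → ∀ m → HomogeneousSeries k (G ^ₛ m)
  homogeneous-^ₛ g zero    zero    = homogeneous-const 1ℚ
  homogeneous-^ₛ g zero    (suc n) = homogeneous-0#
  homogeneous-^ₛ {G} g (suc m)     = homogeneous-*ₛ {G} {G ^ₛ m} g (homogeneous-^ₛ {G} g m)

  -- exp G is built from powers of G with rational coefficients, each of
  -- weight 0.

  homogeneous-exp : ∀ {G} → HomogeneousSeries k G → HomogeneousSeries k (exp G)
  homogeneous-exp {G} g m = homogeneous-sum (suc m) λ i →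
    homogeneous-scale (1/ toℕ i !) (homogeneous-^ₛ {G} g (toℕ i) m)

-- Homogeneity of the coefficients

isPolynomial-t^ : ∀ n → IsPolynomial (t ^ n)
isPolynomial-t^ = isPolynomial-^ ((0ℚ ∷ 1ℚ ∷ []) , ≃-refl)

-- 1 and a multiple of t differ in their constant coefficients.

1-t^-nonZero : ∀ n → NonZero (1# - t ^ suc n)
1-t^-nonZero n 1-tⁿ≃0 with q , e ← isPolynomial-t^ n =
  contradiction (coeff-≡ (polynomial-injective {1ℚ ∷ []} {0ℚ ∷ q} (begin
    1#                         ≈⟨ x∙y⁻¹≈ε⇒x≈y 1# (t * t ^ n) 1-tⁿ≃0 ⟩
    t * t ^ n                  ≈⟨ *-congˡ t e ⟩
    t * polynomial q           ≈⟨ ℚ⟨t⟩.+-identityˡ (t * polynomial q) ⟨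
    0# + t * polynomial q      ≈⟨ +-congʳ (t * polynomial q) (polynomial-cong 0∷[]) ⟨
    const 0ℚ + t * polynomial q ≈⟨ polynomial-∷ 0ℚ q ⟨
    polynomial (0ℚ ∷ q)        ∎)) 0) λ ()
  where
  open ≃-Reasoning
  open GroupProperties ℚ⟨t⟩.+-group using (x∙y⁻¹≈ε⇒x≈y)

telescope : ∀ x y z → x - z ≃ (x - y) + (y - z)
telescope x y z = ≃-sym (begin
  (x - y) + (y - z)  ≈⟨ interchange x (- y) y (- z) ⟩
  (x - z) + (y - y)  ≈⟨ +-congˡ (x - z) (-‿inverseʳ y) ⟩
  (x - z) + 0#       ≈⟨ +-identityʳ (x - z) ⟩
  x - z              ∎)
  where
  open ≃-Reasoning
  interchange : ∀ a b c d → (a + b) + (c + d) ≃ (a + d) + (c + b)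
  interchange = solve-∀ ratFunACR

-- (1 - x^m)/(1 - x) is the geometric sum of length m: for m + 1 it is 1 plus
-- x times its value for m.

geometric-isPolynomial : ∀ {x} → IsPolynomial x → NonZero (1# - x) →
                         ∀ m → IsPolynomial ((1# - x ^ m) ÷ (1# - x))
geometric-isPolynomial {x} p 1-x≄0 zero =
  [] , ≃-trans (*-congʳ ((1# - x) ⁻¹) (-‿inverseʳ 1#)) (ℚ⟨t⟩.zeroˡ ((1# - x) ⁻¹))
geometric-isPolynomial {x} p 1-x≄0 (suc m) =
  isPolynomial-cong (≃-sym step)
    (isPolynomial-+ {1#} ((1ℚ ∷ []) , ≃-refl)
      (isPolynomial-* p (geometric-isPolynomial p 1-x≄0 m)))
  where
  open ≃-Reasoning
  z : RatFun
  z = (1# - x) ⁻¹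
  regroup : ∀ w x e y z → (w + (x * e - x * y)) * z ≃ w * z + x * ((e - y) * z)
  regroup = solve-∀ ratFunACR
  -- 1 - x^(m+1) = (1 - x) + (x - x^(m+1))
  step : (1# - x ^ suc m) ÷ (1# - x) ≃ 1# + x * ((1# - x ^ m) ÷ (1# - x))
  step = begin
    (1# - x * x ^ m) * z
      ≈⟨ *-congʳ z (telescope 1# x (x * x ^ m)) ⟩
    ((1# - x) + (x - x * x ^ m)) * z
      ≈⟨ *-congʳ z (+-congˡ (1# - x) (+-congʳ (- (x * x ^ m)) (ℚ⟨t⟩.*-identityʳ x))) ⟨
    ((1# - x) + (x * 1# - x * x ^ m)) * z
      ≈⟨ regroup (1# - x) x 1# (x ^ m) z ⟩
    (1# - x) * z + x * ((1# - x ^ m) * z)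
      ≈⟨ +-congʳ (x * ((1# - x ^ m) * z)) (⁻¹-inverseʳ 1-x≄0) ⟩
    1# + x * ((1# - x ^ m) * z)
      ∎

-- For v = u⁻¹: replacing u by its inverse changes 1 - u into -u⁻¹ (1 - u).

*-flip : ∀ u v → u * v ≃ 1# → u * (1# - v) ≃ - (1# - u)
*-flip u v uv≃1 = begin
  u * (1# - v)    ≈⟨ expand u 1# v ⟩
  u * 1# - u * v  ≈⟨ +-cong (ℚ⟨t⟩.*-identityʳ u) (-‿cong uv≃1) ⟩
  u - 1#          ≈⟨ swap u 1# ⟩
  - (1# - u)      ∎
  where
  open ≃-Reasoning
  expand : ∀ u e v → u * (e - v) ≃ u * e - u * v
  expand = solve-∀ ratFunACR
  swap : ∀ u e → u - e ≃ - (e - u)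
  swap = solve-∀ ratFunACR

^-inverse : ∀ u v → u * v ≃ 1# → ∀ n → u ^ n * v ^ n ≃ 1#
^-inverse u v uv≃1 zero = *-identityˡ 1#
^-inverse u v uv≃1 (suc n) = begin
  u * u ^ n * (v * v ^ n)    ≈⟨ *-interchange u (u ^ n) v (v ^ n) ⟩
  u * v * (u ^ n * v ^ n)    ≈⟨ *-cong uv≃1 (^-inverse u v uv≃1 n) ⟩
  1# * 1#                    ≈⟨ *-identityˡ 1# ⟩
  1#                         ∎
  where open ≃-Reasoning

^-swap : ∀ x m n → (x ^ m) ^ n ≃ (x ^ n) ^ m
^-swap x m n = begin
  (x ^ m) ^ n    ≈⟨ ^-assocʳ x m n ⟩
  x ^ (m ℕ.* n)  ≈⟨ ^-congʳ x (ℕ.*-comm m n) ⟩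
  x ^ (n ℕ.* m)  ≈⟨ ^-assocʳ x n m ⟨
  (x ^ n) ^ m    ∎
  where open ≃-Reasoning

-- With A = 1 - t^(Mn) and B = 1 - t^n, *-flip gives t^(Mn) σ(A) = -A and
-- t^n σ(B) = -B, while σ(A) = σ(Q) σ(B) for Q = A/B.  Comparing these,
-- Q B = A = t^(Mn - n) σ(Q) B, and B cancels.

quotient-palindromic : ∀ k n → PalindromicOfDarga (k ℕ.* suc n)
  ((1# - (t ^ suc k) ^ suc n) ÷ (1# - t ^ suc n))
quotient-palindromic k n-1 = *-cancelʳ (1-t^-nonZero n-1) (begin
  Q * B
    ≈⟨ QB≃A ⟩
  A
    ≈⟨ -‿involutive A ⟨
  - - A
    ≈⟨ -‿cong (*-flip ((t ^ suc k) ^ n) ((t ⁻¹ ^ suc k) ^ n)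
                (^-inverse (t ^ suc k) (t ⁻¹ ^ suc k) (^-inverse t (t ⁻¹) t*t⁻¹ (suc k)) n)) ⟨
  - ((t ^ suc k) ^ n * (1# - (t ⁻¹ ^ suc k) ^ n))
    ≈⟨ -‿cong (*-congˡ ((t ^ suc k) ^ n) σA) ⟨
  - ((t ^ suc k) ^ n * σ A)
    -- (t^(k+1))^n = t^(n + kn)
    ≈⟨ -‿cong (*-cong (≃-trans (^-assocʳ t (suc k) n) (^-homo-* t n (k ℕ.* n))) σA≃σQσB) ⟩
  - (t ^ n * t ^ (k ℕ.* n) * (σ Q * σ B))
    ≈⟨ regroup (t ^ n) (t ^ (k ℕ.* n)) (σ Q) (σ B) ⟩
  t ^ (k ℕ.* n) * σ Q * - (t ^ n * σ B)
    ≈⟨ *-congˡ (t ^ (k ℕ.* n) * σ Q) (-‿cong tⁿσB≃-B) ⟩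
  t ^ (k ℕ.* n) * σ Q * - - B
    ≈⟨ *-congˡ (t ^ (k ℕ.* n) * σ Q) (-‿involutive B) ⟩
  t ^ (k ℕ.* n) * σ Q * B
    ∎)
  where
  open ≃-Reasoning
  open GroupProperties ℚ⟨t⟩.+-group using () renaming (⁻¹-involutive to -‿involutive)
  n : ℕ
  n = suc n-1
  A B Q : RatFun
  A = 1# - (t ^ suc k) ^ n
  B = 1# - t ^ n
  Q = A ÷ B
  QB≃A : Q * B ≃ A
  QB≃A = ÷-* A (1-t^-nonZero n-1)
  σA≃σQσB : σ A ≃ σ Q * σ B
  σA≃σQσB = ≃-trans (σ-cong (≃-sym QB≃A)) (σ-* Q B)
  σt^ : ∀ m → σ (t ^ m) ≃ t ⁻¹ ^ m
  σt^ m = ≃-trans (σ-^ t m) (^-congˡ m σ-t)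
  σA : σ A ≃ 1# - (t ⁻¹ ^ suc k) ^ n
  σA = ≃-trans (σ-1-^ (t ^ suc k) n) (+-congˡ 1# (-‿cong (^-congˡ n (σt^ (suc k)))))
  tⁿσB≃-B : t ^ n * σ B ≃ - B
  tⁿσB≃-B = begin
    t ^ n * σ B              ≈⟨ *-congˡ (t ^ n) (σ-1-^ t n) ⟩
    t ^ n * (1# - σ t ^ n)   ≈⟨ *-congˡ (t ^ n) (+-congˡ 1# (-‿cong (^-congˡ n σ-t))) ⟩
    t ^ n * (1# - t ⁻¹ ^ n)  ≈⟨ *-flip (t ^ n) (t ⁻¹ ^ n) (^-inverse t (t ⁻¹) t*t⁻¹ n) ⟩
    - B                      ∎
  regroup : ∀ a b c d → - (a * b * (c * d)) ≃ b * c * - (a * d)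
  regroup = solve-∀ ratFunACR

quotient-homogeneous : ∀ k n → Homogeneous k (suc n)
  ((1# - (t ^ suc k) ^ suc n) ÷ (1# - t ^ suc n))
quotient-homogeneous k n = homogeneous
  (isPolynomial-cong
    (*-congʳ ((1# - t ^ suc n) ⁻¹) (+-congˡ 1# (-‿cong (^-swap t (suc n) (suc k)))))
    (geometric-isPolynomial (isPolynomial-t^ (suc n)) (1-t^-nonZero n) (suc k)))
  (quotient-palindromic k n)

homogeneous-whenOdd : ∀ {k n x} p → Homogeneous k n x → Homogeneous k n (whenOdd p x)
homogeneous-whenOdd 0ℙ h = homogeneous-0#
homogeneous-whenOdd 1ℙ h = h

oddSeries-homogeneous : ∀ k → HomogeneousSeries k (oddSeries t (t ^ suc k))
oddSeries-homogeneous k zero    = homogeneous-0#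
oddSeries-homogeneous k (suc n) = homogeneous-whenOdd (parity (suc n))
  (homogeneous-cong (*-comm (const a) Q) (homogeneous-scale a (quotient-homogeneous k n)))
  where
  a : ℚ
  a = + 1 ℚ./ suc n
  Q : RatFun
  Q = (1# - (t ^ suc k) ^ suc n) ÷ (1# - t ^ suc n)

-- The factor -2 is a constant: - const a reduces to const (- a).

f-homogeneous : ∀ k → HomogeneousSeries k f[ suc k ]
f-homogeneous k = homogeneous-exp {G = - const (+ 2 ℚ./ 1) ·ₛ oddSeries t (t ^ suc k)}
  λ n → homogeneous-scale (ℚ.- (+ 2 ℚ./ 1)) (oddSeries-homogeneous k n)

-- - 1# is the constant -1, so its powers have weight 0.

homogeneous-sign : ∀ {k n x} m → Homogeneous k n x → Homogeneous k n ((- 1#) ^ m * x)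
homogeneous-sign m = homogeneous-* (sign m)
  where
  sign : ∀ {k} m → Homogeneous k 0 ((- 1#) ^ m)
  sign zero    = homogeneous-const 1ℚ
  sign (suc m) = homogeneous-scale (ℚ.- 1ℚ) (sign m)

corollary4p3 : (M : ℕ) → 1 ≤ M → (m : ℕ) →
    (f[ M ] m ≃ t ^ ((M ∸ 1) ℕ.* m) * f[ M ] m ⟨ t ⁻¹ ⟩)
    × IsPolynomial ((- 1#) ^ m * f[ M ] m)
    × PalindromicOfDarga ((M ∸ 1) ℕ.* m) ((- 1#) ^ m * f[ M ] m)
corollary4p3 (suc k) _ m = palindromic h , isPolynomial ±h , palindromic ±h
  where
  h : Homogeneous k m (f[ suc k ] m)
  h = f-homogeneous k m
  ±h : Homogeneous k m ((- 1#) ^ m * f[ suc k ] m)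
  ±h = homogeneous-sign m h
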